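{- $[\mathbf{Txt}\mathbf{Td}\mathbf{Ex}_C]_{\mathbf{REC}} = [\mathbf{Txt}\mathbf{Td}\mathbf{Bc}_C]_{\mathbf{REC}}$.
   Context: Fix an acceptable numbering $(\varphi_e)_{e\in\mathbb{N}}$ of all partial computable functions. A number $e$ is a $C$-index if $\varphi_e$ is total with values in $\{0,1\}$; then $C_e=\{x:\varphi_e(x)=1\}$. $\mathbf{REC}$ is the collection of recursive subsets of $\mathbb{N}$; $\mathcal{P}$ denotes the partial computable functions. Fix a pause symbol $\#$. A text is a total function $T:\mathbb{N}\to\mathbb{N}\cup\{\#\}$, $\mathrm{content}(T)=\mathrm{range}(T)\setminus\{\#\}$, $T$ is a text for $L$ if $\mathrm{content}(T)=L$. A learner is some $h\in\mathcal{P}$, which may output a special symbol "?" meaning "no new hypothesis". Transductive hypothesis sequence: $\mathbf{Td}(h,T)(0)=?$, and for $i>0$, $\mathbf{Td}(h,T)(i)=\mathbf{Td}(h,T)(i-1)$ if $h(T(i-1))=?$, else $h(T(i-1))$. Restrictions on hypothesis sequence $p$ and text $T$: $\mathbf{Ex}_C$: there is $n_0$ with $p(n)=p(n_0)$ for all $n\ge n_0$ and $p(n_0)$ a $C$-index with $C_{p(n_0)}=\mathrm{content}(T)$; $\mathbf{Bc}_C$: there is $n_0$ such that for all $n\ge n_0$, $p(n)$ is a $C$-index with $C_{p(n)}=\mathrm{content}(T)$. A learner $h$ $\mathbf{Txt}\mathbf{Td}\delta$-learns $L$ iff $\delta(\mathbf{Td}(h,T),T)$ holds for every text $T$ for $L$;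 $[\mathbf{Txt}\mathbf{Td}\delta]_{\mathbf{REC}}$ is the set of all classes $\mathcal{L}\subseteq\mathbf{REC}$ for which some $h\in\mathcal{P}$ learns every $L\in\mathcal{L}$. -}

module Defs where

open import Data.Nat using (ℕ; zero; suc; _+_; _≤_; _≡ᵇ_)
open import Data.Bool using (if_then_else_)
open import Data.Maybe using (Maybe; just; nothing; _>>=_)
open import Data.Product using (_×_; _,_; Σ; ∃; proj₁; proj₂)
open import Data.Sum using (_⊎_)
open import Function.Bundles using (_⇔_)
open import Relation.Binary.PropositionalEquality using (_≡_)

tri : ℕ → ℕ
tri zero    = zero
tri (suc d) = suc d + tri d

pair : ℕ → ℕ → ℕ
pair x y = tri (x + y) + y

unpair : ℕ → ℕ × ℕ
unpair zero = 0 , 0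
unpair (suc n) with unpair n
... | zero  , y = suc y , 0
... | suc x , y = x , suc y

-- A concrete model of the partial computable (unary) functions:
-- Kleene's μ-recursive functions, made unary by Cantor pairing.

data Code : Set where
  cZero cSucc cId cFst cSnd : Code
  cPair cComp cRec : Code → Code → Code
  cMu : Code → Code

-- step-indexed evaluation (monotone in the fuel s)
eval : ℕ → Code → ℕ → Maybe ℕ
eval zero    _           _ = nothing
eval (suc s) cZero       x = just 0
eval (suc s) cSucc       x = just (suc x)
eval (suc s) cId         x = just x
eval (suc s) cFst        x = just (proj₁ (unpair x))
eval (suc s) cSnd        x = just (proj₂ (unpair x))
eval (suc s) (cPair f g) x =
  eval s f x >>= λ a → eval s g x >>= λ b → just (pair a b)
eval (suc s) (cComp f g) x = eval s g x >>= eval s f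
eval (suc s) (cRec f g)  x = loop (proj₁ (unpair x))
  where
  y = proj₂ (unpair x)
  loop : ℕ → Maybe ℕ
  loop zero    = eval s f y
  loop (suc k) = loop k >>= λ r → eval s g (pair k (pair r y))
eval (suc s) (cMu f)     x = search s 0
  where
  search : ℕ → ℕ → Maybe ℕ
  search zero    n = nothing
  search (suc r) n = eval s f (pair n x) >>= λ v →
                       if v ≡ᵇ 0 then just n else search r (suc n)

decodeF : ℕ → ℕ → Code
decodeF zero    e = cZero
decodeF (suc f) e = go (proj₁ (unpair e)) (proj₂ (unpair e))
  where
  l r : ℕ → Code
  l m = decodeF f (proj₁ (unpair m))
  r m = decodeF f (proj₂ (unpair m))
  go : ℕ → ℕ → Code
  go 0 m = cZero
  go 1 m = cSucc
  go 2 m = cId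
  go 3 m = cFst
  go 4 m = cSnd
  go 5 m = cPair (l m) (r m)
  go 6 m = cComp (l m) (r m)
  go 7 m = cRec (l m) (r m)
  go 8 m = cMu (decodeF f m)
  go _ m = cZero

decode : ℕ → Code
decode e = decodeF (suc e) e

_·_⇓_ : ℕ → ℕ → ℕ → Set
e · x ⇓ y = ∃ λ s → eval s (decode e) x ≡ just y

Language : Set₁
Language = ℕ → Set

IsCIndex : ℕ → Set
IsCIndex e = ∀ x → ∃ λ y → (e · x ⇓ y) × y ≤ 1

C : ℕ → Language
C e x = e · x ⇓ 1

Recursive : Language → Set
Recursive L = ∃ λ e → IsCIndex e × (∀ x → C e x ⇔ L x)

-- Texts: nothing = pause symbol #

Text : Set
Text = ℕ → Maybe ℕ

content : Text → Language
content T x = ∃ λ i → T i ≡ just x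

TextFor : Text → Language → Set
TextFor T L = ∀ x → content T x ⇔ L x

-- Hypothesis sequences: nothing = "?"
HypSeq : Set
HypSeq = ℕ → Maybe ℕ

-- Learners are indices h of partial computable functions.
-- Input coding:  # ↦ 0,  n ↦ n+1.   Output coding:  0 ↦ ?,  e+1 ↦ e.
encIn : Maybe ℕ → ℕ
encIn nothing  = 0
encIn (just n) = suc n

-- p is (the, necessarily total) transductive hypothesis sequence Td(h,T)
IsTd : ℕ → Text → HypSeq → Set
IsTd h T p =
  (p 0 ≡ nothing) ×
  (∀ i → ((h · encIn (T i) ⇓ 0) × p (suc i) ≡ p i)
       ⊎ (∃ λ e → (h · encIn (T i) ⇓ suc e) × p (suc i) ≡ just e))

Criterion : Set₁
Criterion = HypSeq → Text → Set

CorrectC : ℕ → Text → Set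
CorrectC e T = IsCIndex e × (∀ x → C e x ⇔ content T x)

ExC : Criterion
ExC p T = ∃ λ n₀ → ∃ λ e → (∀ n → n₀ ≤ n → p n ≡ just e) × CorrectC e T

BcC : Criterion
BcC p T = ∃ λ n₀ → ∀ n → n₀ ≤ n → ∃ λ e → (p n ≡ just e) × CorrectC e T

TdLearns : Criterion → ℕ → Language → Set
TdLearns δ h L = ∀ T → TextFor T L → ∃ λ p → IsTd h T p × δ p T

Class : Set₁
Class = Language → Set

-- 𝓛 ∈ [TxtTdδ]_REC  (given 𝓛 ⊆ REC)
TdLearnable : Criterion → Class → Set₁
TdLearnable δ 𝓛 = ∃ λ h → ∀ L → 𝓛 L → TdLearns δ h L

{-# OPTIONS --safe #-}

-- Ex ⊆ Bc is immediate. Let conversely h be a Bc-learner of L. Any datum z (an element of L or #)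
-- may recur forever in a text for L, so a conjecture h(z) ≠ ? recurs in the hypothesis sequence and
-- must be correct. Hence an Ex-learner can, on z with h(z) = e ≠ ?, use a universal program to
-- enumerate the data n in C_e ∪ {#} and answer h(n) for the least such n with h(n) ≠ ?; as
-- C_e = L, this n does not depend on z.
module Submission where

open import Defs
open import Data.Bool using (if_then_else_)
open import Data.List using (List; []; _∷_)
open import Data.Maybe using (Maybe; just; nothing; _>>=_)
open import Data.Maybe.Properties using (just-injective)
open import Data.Nat
open import Data.Nat.GeneralisedArithmetic using (iterate; fold; iterate-is-fold)
open import Data.Nat.Properties
open import Data.Product using (_×_; _,_; ∃; proj₁; proj₂)
open import Data.Sum as Sum using (_⊎_; inj₁; inj₂)
open import Data.Unit using (⊤; tt)
open import Function using (_∘_)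
open import Function.Bundles using (_⇔_; mk⇔; module Equivalence)
open import Relation.Binary.PropositionalEquality
open import Relation.Nullary using (¬_; Dec; yes; no; contradiction)
open import Relation.Unary using (Decidable)
open Equivalence using (to; from)

-- Cantor pairing and least witnesses.

unpair-pair : ∀ x y → unpair (pair x y) ≡ (x , y)
unpair-pair x y = diagonal (x + y) x y refl
  where
  -- Follows the enumeration of `unpair` backwards: the predecessor of `(x , suc y)` is
  -- `(suc x , y)` on the same diagonal, that of `(suc x , 0)` is `(0 , x)` on the previous one.
  diagonal : ∀ d x y → x + y ≡ d → unpair (tri d + y) ≡ (x , y)
  diagonal zero    zero    zero    refl = refl
  diagonal (suc d) (suc x) zero    refl
    rewrite +-identityʳ x | +-identityʳ (x + tri x) | +-comm x (tri x) | diagonal x zero x refl = refl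
  diagonal d       x       (suc y) eq
    rewrite +-suc (tri d) y | diagonal d (suc x) y (trans (sym (+-suc x y)) eq) = refl

-- Recursive decoding passes to the components of an index; this bound keeps the fuel of `decodeF`
-- above them.
unpair-sum-≤ : ∀ n → proj₁ (unpair n) + proj₂ (unpair n) ≤ n
unpair-sum-≤ zero = z≤n
unpair-sum-≤ (suc n) with unpair n | unpair-sum-≤ n
... | zero  , y | le = s≤s (subst (_≤ n) (sym (+-identityʳ y)) le)
... | suc x , y | le = subst (_≤ suc n) (sym (+-suc x y)) (m≤n⇒m≤1+n le)

+-≤-pair : ∀ x y → x + y ≤ pair x y
+-≤-pair x y = subst (λ p → proj₁ p + proj₂ p ≤ pair x y) (unpair-pair x y) (unpair-sum-≤ (pair x y))

least : ∀ {P : ℕ → Set} → Decidable P → ∀ n → P n → ∃ λ m → P m × (∀ {k} → k < m → ¬ P k)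
least {P} P? n pn with P? 0
... | yes p0 = 0 , p0 , λ ()
least {P} P? zero    pn | no ¬p0 = contradiction pn ¬p0
least {P} P? (suc n) pn | no ¬p0 with least (P? ∘ suc) n pn
... | m , pm , below = suc m , pm , below′
  where
  below′ : ∀ {k} → k < suc m → ¬ P k
  below′ {zero}  _         = ¬p0
  below′ {suc k} (s≤s k<m) = below k<m

-- Big-step semantics of codes

infix 4 _⊢_↦_

data _⊢_↦_ : Code → ℕ → ℕ → Set
data Loop (f g : Code) (y : ℕ) : ℕ → ℕ → Set
data Search (f : Code) (x : ℕ) : ℕ → ℕ → Set

-- Derivations carry no fuel, so programs can be composed without counting steps.
data _⊢_↦_ where
  ⊢zero : ∀ {x} → cZero ⊢ x ↦ 0
  ⊢succ : ∀ {x} → cSucc ⊢ x ↦ suc x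
  ⊢id   : ∀ {x} → cId ⊢ x ↦ x
  ⊢fst  : ∀ {x} → cFst ⊢ x ↦ proj₁ (unpair x)
  ⊢snd  : ∀ {x} → cSnd ⊢ x ↦ proj₂ (unpair x)
  ⊢pair : ∀ {f g x a b} → f ⊢ x ↦ a → g ⊢ x ↦ b → cPair f g ⊢ x ↦ pair a b
  ⊢comp : ∀ {f g x a b} → g ⊢ x ↦ a → f ⊢ a ↦ b → cComp f g ⊢ x ↦ b
  ⊢rec  : ∀ {f g x v} → Loop f g (proj₂ (unpair x)) (proj₁ (unpair x)) v → cRec f g ⊢ x ↦ v
  ⊢mu   : ∀ {f x v} → Search f x 0 v → cMu f ⊢ x ↦ v

data Loop f g y where
  base : ∀ {v} → f ⊢ y ↦ v → Loop f g y 0 v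
  step : ∀ {k r v} → Loop f g y k r → g ⊢ pair k (pair r y) ↦ v → Loop f g y (suc k) v

data Search f x where
  found : ∀ {n} → f ⊢ pair n x ↦ 0 → Search f x n n
  next  : ∀ {n w m} → f ⊢ pair n x ↦ suc w → Search f x (suc n) m → Search f x n m

-- The local functions loop and search of eval cannot be named from outside, so they are
-- characterised by their recursion equations and recovered by unification.

loopF : Maybe ℕ → (ℕ → ℕ → Maybe ℕ) → ℕ → Maybe ℕ
loopF b g zero    = b
loopF b g (suc k) = loopF b g k >>= g k

searchF : (ℕ → Maybe ℕ) → ℕ → ℕ → Maybe ℕ
searchF f zero    n = nothing
searchF f (suc r) n = f n >>= λ v → if v ≡ᵇ 0 then just n else searchF f r (suc n)

>>=-cong : ∀ (m : Maybe ℕ) {f g : ℕ → Maybe ℕ} → (∀ v → f v ≡ g v) → (m >>= f) ≡ (m >>= g)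
>>=-cong nothing  f≗g = refl
>>=-cong (just x) f≗g = f≗g x

>>=-just : ∀ {m : Maybe ℕ} {v} {f : ℕ → Maybe ℕ} → m ≡ just v → (m >>= f) ≡ f v
>>=-just refl = refl

loopF-unique : ∀ b g (l : ℕ → Maybe ℕ) → l 0 ≡ b → (∀ k → l (suc k) ≡ (l k >>= g k)) →
               ∀ k → l k ≡ loopF b g k
loopF-unique b g l l0 l+ zero    = l0
loopF-unique b g l l0 l+ (suc k) = trans (l+ k) (cong (_>>= g k) (loopF-unique b g l l0 l+ k))

searchF-unique : ∀ f (l : ℕ → ℕ → Maybe ℕ) → (∀ n → l 0 n ≡ nothing) →
                 (∀ r n → l (suc r) n ≡ (f n >>= λ v → if v ≡ᵇ 0 then just n else l r (suc n))) →
                 ∀ r n → l r n ≡ searchF f r n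
searchF-unique f l l0 l+ zero    n = l0 n
searchF-unique f l l0 l+ (suc r) n =
  trans (l+ r n) (>>=-cong (f n) λ v → cong (if v ≡ᵇ 0 then just n else_) (searchF-unique f l l0 l+ r (suc n)))

eval-rec : ∀ s f g x → let y = proj₂ (unpair x) in
  eval (suc s) (cRec f g) x ≡
  loopF (eval s f y) (λ k r → eval s g (pair k (pair r y))) (proj₁ (unpair x))
eval-rec s f g x
  with loopF-unique (eval s f (proj₂ (unpair x)))
                    (λ k r → eval s g (pair k (pair r (proj₂ (unpair x))))) _ refl (λ _ → refl)
     -- Once the iteration count is a variable, the goal determines the underscore as the local
     -- `loop`.
     | proj₁ (unpair x)
... | unique | k = unique k

eval-mu : ∀ s f x → eval (suc s) (cMu f) x ≡ searchF (λ n → eval s f (pair n x)) s 0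
eval-mu zero    f x = refl
eval-mu (suc s) f x with eval (suc s) f (pair 0 x)
... | nothing      = refl
... | just zero    = refl
... | just (suc v) with suc s
-- One candidate has been unfolded by hand. Inner fuel, next candidate and remaining count are now
-- independent variables, as unification requires.
... | p with searchF-unique (λ n → eval p f (pair n x)) _ (λ _ → refl) (λ _ _ → refl) | 1 | s
... | unique | n | r = unique r n

-- Equivalence of derivations and fuelled evaluation.

eval-complete : ∀ s c x {v} → eval s c x ≡ just v → c ⊢ x ↦ v
eval-complete (suc s) cZero x refl = ⊢zero
eval-complete (suc s) cSucc x refl = ⊢succ
eval-complete (suc s) cId x refl = ⊢id
eval-complete (suc s) cFst x refl = ⊢fst
eval-complete (suc s) cSnd x refl = ⊢snd
eval-complete (suc s) (cPair f g) x eq with eval s f x in eqf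
... | just a with eval s g x in eqg
...   | just b with refl ← eq = ⊢pair (eval-complete s f x eqf) (eval-complete s g x eqg)
eval-complete (suc s) (cComp f g) x eq with eval s g x in eqg
... | just a = ⊢comp (eval-complete s g x eqg) (eval-complete s f a eq)
eval-complete (suc s) (cRec f g) x eq =
  ⊢rec (complete-loop (proj₁ (unpair x)) (trans (sym (eval-rec s f g x)) eq))
  where
  y = proj₂ (unpair x)
  l = loopF (eval s f y) (λ k r → eval s g (pair k (pair r y)))
  complete-loop : ∀ k {v} → l k ≡ just v → Loop f g y k v
  complete-loop zero    eq = base (eval-complete s f y eq)
  complete-loop (suc k) eq with l k in eqk
  ... | just r = step (complete-loop k eqk) (eval-complete s g _ eq)
eval-complete (suc s) (cMu f) x eq = ⊢mu (complete-search s 0 (trans (sym (eval-mu s f x)) eq))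
  where
  complete-search : ∀ r n {v} → searchF (λ n → eval s f (pair n x)) r n ≡ just v → Search f x n v
  complete-search (suc r) n eq with eval s f (pair n x) in eqn
  complete-search (suc r) n refl | just zero = found (eval-complete s f _ eqn)
  complete-search (suc r) n eq   | just (suc w) = next (eval-complete s f _ eqn) (complete-search r (suc n) eq)

-- Asking for all large fuel builds monotonicity into the induction: subderivations are combined at
-- the maximum of their bounds.
Eventually : Code → ℕ → ℕ → Set
Eventually c x v = ∃ λ s₀ → ∀ {s} → s₀ ≤ s → eval s c x ≡ just v

eval-sound : ∀ {c x v} → c ⊢ x ↦ v → Eventually c x v
loop-sound : ∀ {f g y k v} → Loop f g y k v → ∃ λ s₀ → ∀ {s} → s₀ ≤ s →
             loopF (eval s f y) (λ k r → eval s g (pair k (pair r y))) k ≡ just v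
-- Fuel `s` and remaining count `r` vary separately, since the search uses up `r` while every test
-- runs with the same `s`.
search-sound : ∀ {f x n m} → Search f x n m → ∃ λ s₀ → ∀ {s r} → s₀ ≤ s → s₀ ≤ r →
               searchF (λ n → eval s f (pair n x)) r n ≡ just m

eval-sound ⊢zero = 1 , λ { (s≤s _) → refl }
eval-sound ⊢succ = 1 , λ { (s≤s _) → refl }
eval-sound ⊢id   = 1 , λ { (s≤s _) → refl }
eval-sound ⊢fst  = 1 , λ { (s≤s _) → refl }
eval-sound ⊢snd  = 1 , λ { (s≤s _) → refl }
eval-sound (⊢pair {f} {g} {x} {a} {b} df dg) with eval-sound df | eval-sound dg
... | s₁ , h₁ | s₂ , h₂ = suc (s₁ ⊔ s₂) , fuelled
  where
  fuelled : ∀ {s} → suc (s₁ ⊔ s₂) ≤ s → eval s (cPair f g) x ≡ just (pair a b)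
  fuelled (s≤s le) rewrite h₁ (m⊔n≤o⇒m≤o s₁ s₂ le) | h₂ (m⊔n≤o⇒n≤o s₁ s₂ le) = refl
eval-sound (⊢comp {f} {g} {x} {a} {b} dg df) with eval-sound dg | eval-sound df
... | s₁ , h₁ | s₂ , h₂ = suc (s₁ ⊔ s₂) , fuelled
  where
  fuelled : ∀ {s} → suc (s₁ ⊔ s₂) ≤ s → eval s (cComp f g) x ≡ just b
  fuelled (s≤s le) rewrite h₁ (m⊔n≤o⇒m≤o s₁ s₂ le) = h₂ (m⊔n≤o⇒n≤o s₁ s₂ le)
eval-sound (⊢rec {f} {g} {x} l) with loop-sound l
... | s₀ , h = suc s₀ , λ { (s≤s {n = s} le) → trans (eval-rec s f g x) (h le) }
eval-sound (⊢mu {f} {x} d) with search-sound d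
... | s₀ , h = suc s₀ , λ { (s≤s {n = s} le) → trans (eval-mu s f x) (h le le) }

loop-sound (base d) = eval-sound d
loop-sound (step {k} {r} {v} l d) with loop-sound l | eval-sound d
... | s₁ , h₁ | s₂ , h₂ = s₁ ⊔ s₂ , λ le →
  trans (>>=-just (h₁ (m⊔n≤o⇒m≤o s₁ s₂ le))) (h₂ (m⊔n≤o⇒n≤o s₁ s₂ le))

search-sound (found d) with eval-sound d
... | s₀ , h = suc s₀ , λ { le (s≤s _) → >>=-just (h (<⇒≤ le)) }
search-sound (next d ds) with eval-sound d | search-sound ds
... | s₁ , h₁ | s₂ , h₂ = suc (s₁ ⊔ s₂) , λ { le (s≤s le′) →
  trans (>>=-just (h₁ (m⊔n≤o⇒m≤o s₁ s₂ (<⇒≤ le))))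
        (h₂ (m⊔n≤o⇒n≤o s₁ s₂ (<⇒≤ le)) (m⊔n≤o⇒n≤o s₁ s₂ le′)) }

⊢⇒⇓ : ∀ {e x v} → decode e ⊢ x ↦ v → e · x ⇓ v
⊢⇒⇓ d = proj₁ (eval-sound d) , proj₂ (eval-sound d) ≤-refl

⇓⇒⊢ : ∀ {e x v} → e · x ⇓ v → decode e ⊢ x ↦ v
⇓⇒⊢ {e} {x} (s , eq) = eval-complete s (decode e) x eq

⊢-deterministic : ∀ {c x v w} → c ⊢ x ↦ v → c ⊢ x ↦ w → v ≡ w
⊢-deterministic d d′ with eval-sound d | eval-sound d′
... | s₁ , h₁ | s₂ , h₂ = just-injective (trans (sym (h₁ (m≤m⊔n s₁ s₂))) (h₂ (m≤n⊔m s₁ s₂)))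

⇓-deterministic : ∀ {e x v w} → e · x ⇓ v → e · x ⇓ w → v ≡ w
⇓-deterministic e↓v e↓w = ⊢-deterministic (⇓⇒⊢ e↓v) (⇓⇒⊢ e↓w)

-- Every code has an index.

encode : Code → ℕ
encode cZero = pair 0 0
encode cSucc = pair 1 0
encode cId   = pair 2 0
encode cFst  = pair 3 0
encode cSnd  = pair 4 0
encode (cPair f g) = pair 5 (pair (encode f) (encode g))
encode (cComp f g) = pair 6 (pair (encode f) (encode g))
encode (cRec f g)  = pair 7 (pair (encode f) (encode g))
encode (cMu f)     = pair 8 (encode f)

-- One layer of `decodeF` with the decoder of the children as a parameter; unlike the local
-- functions there, it can be rewritten along an equation for the unpaired index.
decodeNode : (ℕ → Code) → ℕ × ℕ → Code
decodeNode d (0 , m) = cZero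
decodeNode d (1 , m) = cSucc
decodeNode d (2 , m) = cId
decodeNode d (3 , m) = cFst
decodeNode d (4 , m) = cSnd
decodeNode d (5 , m) = cPair (d (proj₁ (unpair m))) (d (proj₂ (unpair m)))
decodeNode d (6 , m) = cComp (d (proj₁ (unpair m))) (d (proj₂ (unpair m)))
decodeNode d (7 , m) = cRec (d (proj₁ (unpair m))) (d (proj₂ (unpair m)))
decodeNode d (8 , m) = cMu (d m)
decodeNode d (_ , m) = cZero

decodeF-suc : ∀ f e → decodeF (suc f) e ≡ decodeNode (decodeF f) (unpair e)
decodeF-suc f e with unpair e
... | 0 , m = refl
... | 1 , m = refl
... | 2 , m = refl
... | 3 , m = refl
... | 4 , m = refl
... | 5 , m = refl
... | 6 , m = refl
... | 7 , m = refl
... | 8 , m = refl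
... | suc (suc (suc (suc (suc (suc (suc (suc (suc _)))))))) , m = refl

decodeF-pair : ∀ f t m → decodeF (suc f) (pair t m) ≡ decodeNode (decodeF f) (t , m)
decodeF-pair f t m = trans (decodeF-suc f (pair t m)) (cong (decodeNode (decodeF f)) (unpair-pair t m))

-- A nonzero tag makes the payload strictly smaller than the index, so the fuel left suffices for
-- the payload.
pair-< : ∀ t m {f} → pair (suc t) m < suc f → m < f
pair-< t m (s≤s le) = ≤-trans (s≤s (m≤n+m m t)) (≤-trans (+-≤-pair (suc t) m) le)

-- The fuel is any bound above the index, because children are decoded with the fuel left over from
-- their parent.
decodeF-encode : ∀ c {f} → encode c < f → decodeF f (encode c) ≡ c
decode-children : ∀ t (op : Code → Code → Code) c d {f} → pair (suc t) (pair (encode c) (encode d)) < suc f →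
                  let m = unpair (pair (encode c) (encode d)) in
                  op (decodeF f (proj₁ m)) (decodeF f (proj₂ m)) ≡ op c d

decode-children t op c d {f} lt rewrite unpair-pair (encode c) (encode d) =
  cong₂ op (decodeF-encode c (≤-<-trans (m≤m+n _ _) children<f))
           (decodeF-encode d (≤-<-trans (m≤n+m _ _) children<f))
  where
  children<f : encode c + encode d < f
  children<f = ≤-<-trans (+-≤-pair (encode c) (encode d)) (pair-< t (pair (encode c) (encode d)) lt)

decodeF-encode cZero {suc f} lt = decodeF-pair f 0 0
decodeF-encode cSucc {suc f} lt = decodeF-pair f 1 0
decodeF-encode cId   {suc f} lt = decodeF-pair f 2 0
decodeF-encode cFst  {suc f} lt = decodeF-pair f 3 0
decodeF-encode cSnd  {suc f} lt = decodeF-pair f 4 0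
decodeF-encode (cPair c d) {suc f} lt =
  trans (decodeF-pair f 5 (pair (encode c) (encode d))) (decode-children 4 cPair c d lt)
decodeF-encode (cComp c d) {suc f} lt =
  trans (decodeF-pair f 6 (pair (encode c) (encode d))) (decode-children 5 cComp c d lt)
decodeF-encode (cRec c d) {suc f} lt =
  trans (decodeF-pair f 7 (pair (encode c) (encode d))) (decode-children 6 cRec c d lt)
decodeF-encode (cMu c)     {suc f} lt =
  trans (decodeF-pair f 8 (encode c)) (cong cMu (decodeF-encode c (pair-< 7 (encode c) lt)))

decode-encode : ∀ c → decode (encode c) ≡ c
decode-encode c = decodeF-encode c ≤-refl

-- abstract: the normal form of a concrete index is astronomically large.
abstract
  hasIndex : ∀ c → ∃ λ e → decode e ≡ c
  hasIndex c = encode c , decode-encode c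

-- Derived program constructs.

⊢fst-pair : ∀ a b → cFst ⊢ pair a b ↦ a
⊢fst-pair a b = subst (cFst ⊢ pair a b ↦_) (cong proj₁ (unpair-pair a b)) ⊢fst

⊢snd-pair : ∀ a b → cSnd ⊢ pair a b ↦ b
⊢snd-pair a b = subst (cSnd ⊢ pair a b ↦_) (cong proj₂ (unpair-pair a b)) ⊢snd

⊢rec-pair : ∀ {f g v} k y → Loop f g y k v → cRec f g ⊢ pair k y ↦ v
⊢rec-pair {f} {g} {v} k y l =
  ⊢rec (subst (λ p → Loop f g (proj₂ p) (proj₁ p) v) (sym (unpair-pair k y)) l)

-- Primitive recursion as case distinction: the step keeps the predecessor and the parameter and
-- drops the recursive value.
natCase : Code → Code → Code
natCase f g = cRec f (cComp g (cPair cFst (cComp cSnd cSnd)))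

⊢natCase-zero : ∀ {f g y v} → f ⊢ y ↦ v → natCase f g ⊢ pair 0 y ↦ v
⊢natCase-zero {y = y} df = ⊢rec-pair 0 y (base df)

-- `cRec` passes through the base case and all lower iterations, so `g` has to converge at every
-- `k`.
⊢natCase-suc : ∀ {f g y w} (h : ℕ → ℕ) → f ⊢ y ↦ w → (∀ k → g ⊢ pair k y ↦ h k) →
               ∀ k → natCase f g ⊢ pair (suc k) y ↦ h k
⊢natCase-suc {f} {g} {y} {w} h df dg k = ⊢rec-pair (suc k) y (loop k)
  where
  body : ∀ k r → cComp g (cPair cFst (cComp cSnd cSnd)) ⊢ pair k (pair r y) ↦ h k
  body k r = ⊢comp (⊢pair (⊢fst-pair k (pair r y)) (⊢comp (⊢snd-pair k (pair r y)) (⊢snd-pair r y))) (dg k)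
  loop : ∀ k → Loop f (cComp g (cPair cFst (cComp cSnd cSnd))) y (suc k) (h k)
  loop zero    = step (base df) (body 0 w)
  loop (suc k) = step (loop k) (body (suc k) (h k))

ifZero : Code → Code → Code → Code
ifZero c f g = cComp (natCase f (cComp g cSnd)) (cPair c cId)

⊢ifZero-zero : ∀ {c f g x v} → c ⊢ x ↦ 0 → f ⊢ x ↦ v → ifZero c f g ⊢ x ↦ v
⊢ifZero-zero dc df = ⊢comp (⊢pair dc ⊢id) (⊢natCase-zero df)

-- cRec runs its base case before every iteration, so f has to converge here too.
⊢ifZero-suc : ∀ {c f g x k w v} → c ⊢ x ↦ suc k → f ⊢ x ↦ w → g ⊢ x ↦ v → ifZero c f g ⊢ x ↦ v
⊢ifZero-suc {x = x} {k} {v = v} dc df dg =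
  ⊢comp (⊢pair dc ⊢id) (⊢natCase-suc (λ _ → v) df (λ k → ⊢comp (⊢snd-pair k x) dg) k)

⊢mu-least : ∀ {P : ℕ → Set} {c x m} →
            (∀ n → P n → c ⊢ pair n x ↦ 0) → (∀ n → ¬ P n → ∃ λ w → c ⊢ pair n x ↦ suc w) →
            P m → (∀ {k} → k < m → ¬ P k) → cMu c ⊢ x ↦ m
⊢mu-least {P} {c} {x} {m} yes-zero no-suc pm below =
  ⊢mu (subst (λ n → Search c x n m) (n∸n≡0 m) (searchFrom m ≤-refl))
  where
  -- Induction on the distance `k` that the search still has to cover to reach `m`.
  searchFrom : ∀ k → k ≤ m → Search c x (m ∸ k) m
  searchFrom zero    _   = found (yes-zero m pm)
  searchFrom (suc k) k<m =
    next (proj₂ (no-suc (m ∸ suc k) (below (∸-monoʳ-< z<s k<m))))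
         (subst (λ n → Search c x n m) (sym (suc-pred-∸ k k<m)) (searchFrom k (<⇒≤ k<m)))
    where
    suc-pred-∸ : ∀ k → k < m → suc (m ∸ suc k) ≡ m ∸ k
    suc-pred-∸ k k<m = sym (+-∸-assoc 1 k<m)

-- A typed total language compiled to codes

infixr 5 _⊗_

data Ty : Set where
  nat  : Ty
  _⊗_  : Ty → Ty → Ty
  list : Ty → Ty

⟦_⟧ : Ty → Set
⟦ nat ⟧    = ℕ
⟦ A ⊗ B ⟧  = ⟦ A ⟧ × ⟦ B ⟧
⟦ list A ⟧ = List ⟦ A ⟧

-- As `pair 0 0` is 0, the first component of a list code is always its tag, 0 for empty and 1 for a
-- cell.
⌜_⌝ : ∀ {A} → ⟦ A ⟧ → ℕ
⌜_⌝ {nat}    n        = n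
⌜_⌝ {A ⊗ B}  (a , b)  = pair (⌜_⌝ {A} a) (⌜_⌝ {B} b)
⌜_⌝ {list A} []       = 0
⌜_⌝ {list A} (x ∷ xs) = pair 1 (pair (⌜_⌝ {A} x) (⌜_⌝ {list A} xs))

infixr 5 _∷′_ _∣_
infix  6 ⟨_,_⟩

data Tm (A : Ty) : Ty → Set
data Alts (A B : Ty) : Set

-- Terms are total, so even the branches not taken converge, as the rules for `natCase` demand.
data Tm A where
  arg     : Tm A A
  zero′   : Tm A nat
  suc′    : Tm A nat → Tm A nat
  ⟨_,_⟩   : ∀ {B C} → Tm A B → Tm A C → Tm A (B ⊗ C)
  fst′    : ∀ {B C} → Tm A (B ⊗ C) → Tm A B
  snd′    : ∀ {B C} → Tm A (B ⊗ C) → Tm A C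
  pair′   : Tm A nat → Tm A nat → Tm A nat
  unpair′ : Tm A nat → Tm A (nat ⊗ nat)
  []′     : ∀ {B} → Tm A (list B)
  _∷′_    : ∀ {B} → Tm A B → Tm A (list B) → Tm A (list B)
  uncons  : ∀ {B C} → Tm A (list B) → Tm A C → Tm ((B ⊗ list B) ⊗ A) C → Tm A C
  switch  : ∀ {B} → Tm A nat → Alts A B → Tm A B

-- `otherwise` receives the excess of the scrutinee over the number of earlier alternatives; after a
-- single one this is the predecessor.
data Alts A B where
  otherwise : Tm (nat ⊗ A) B → Alts A B
  _∣_       : Tm A B → Alts A B → Alts A B

run  : ∀ {A B} → Tm A B → ⟦ A ⟧ → ⟦ B ⟧
runA : ∀ {A B} → Alts A B → ℕ → ⟦ A ⟧ → ⟦ B ⟧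

unconsWith : ∀ {X Y : Set} → List X → Y → (X × List X → Y) → Y
unconsWith []       y f = y
unconsWith (x ∷ xs) y f = f (x , xs)

run arg            a = a
run zero′          a = 0
run (suc′ t)       a = suc (run t a)
run ⟨ t , u ⟩      a = run t a , run u a
run (fst′ t)       a = proj₁ (run t a)
run (snd′ t)       a = proj₂ (run t a)
run (pair′ t u)    a = pair (run t a) (run u a)
run (unpair′ t)    a = unpair (run t a)
run []′            a = []
run (t ∷′ u)       a = run t a ∷ run u a
run (uncons l n c) a = unconsWith (run l a) (run n a) (λ p → run c (p , a))
run (switch t as)  a = runA as (run t a) a

runA (otherwise t) k       a = run t (k , a)
runA (t ∣ as)      zero    a = run t a
runA (t ∣ as)      (suc k) a = runA as k a

compile  : ∀ {A B} → Tm A B → Code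
compileA : ∀ {A B} → Alts A B → Code

compile arg            = cId
compile zero′          = cZero
compile (suc′ t)       = cComp cSucc (compile t)
compile ⟨ t , u ⟩      = cPair (compile t) (compile u)
compile (fst′ t)       = cComp cFst (compile t)
compile (snd′ t)       = cComp cSnd (compile t)
compile (pair′ t u)    = cPair (compile t) (compile u)
compile (unpair′ t)    = cComp (cPair cFst cSnd) (compile t)
compile []′            = cZero
compile (t ∷′ u)       = cPair (cComp cSucc cZero) (cPair (compile t) (compile u))
compile (uncons l n c) =
  cComp (ifZero (cComp cFst cFst) (cComp (compile n) cSnd) (cComp (compile c) (cPair (cComp cSnd cFst) cSnd)))
        (cPair (compile l) cId)
compile (switch t as)  = cComp (compileA as) (cPair (compile t) cId)

compileA (otherwise t) = compile t
compileA (t ∣ as)      = natCase (compile t) (compileA as)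

⊢compile  : ∀ {A B} (t : Tm A B) (a : ⟦ A ⟧) → compile t ⊢ ⌜_⌝ {A} a ↦ ⌜_⌝ {B} (run t a)
⊢compileA : ∀ {A B} (as : Alts A B) k (a : ⟦ A ⟧) → compileA as ⊢ pair k (⌜_⌝ {A} a) ↦ ⌜_⌝ {B} (runA as k a)

⊢compile arg            a = ⊢id
⊢compile zero′          a = ⊢zero
⊢compile (suc′ t)       a = ⊢comp (⊢compile t a) ⊢succ
⊢compile ⟨ t , u ⟩      a = ⊢pair (⊢compile t a) (⊢compile u a)
⊢compile (fst′ {B} {C} t) a =
  ⊢comp (⊢compile t a) (⊢fst-pair (⌜_⌝ {B} (proj₁ (run t a))) (⌜_⌝ {C} (proj₂ (run t a))))
⊢compile (snd′ {B} {C} t) a =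
  ⊢comp (⊢compile t a) (⊢snd-pair (⌜_⌝ {B} (proj₁ (run t a))) (⌜_⌝ {C} (proj₂ (run t a))))
⊢compile (pair′ t u)    a = ⊢pair (⊢compile t a) (⊢compile u a)
⊢compile (unpair′ t)    a = ⊢comp (⊢compile t a) (⊢pair ⊢fst ⊢snd)
⊢compile []′            a = ⊢zero
⊢compile (t ∷′ u)       a = ⊢pair (⊢comp ⊢zero ⊢succ) (⊢pair (⊢compile t a) (⊢compile u a))
⊢compile {A} (uncons {B} l n c) a with run l a | ⊢compile l a
... | []     | dl = ⊢comp (⊢pair dl ⊢id)
  (⊢ifZero-zero (⊢comp (⊢fst-pair 0 (⌜_⌝ {A} a)) ⊢fst) (⊢comp (⊢snd-pair 0 (⌜_⌝ {A} a)) (⊢compile n a)))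
... | x ∷ xs | dl = ⊢comp (⊢pair dl ⊢id)
  (⊢ifZero-suc (⊢comp (⊢fst-pair cell env) (⊢fst-pair 1 parts))
    (⊢comp (⊢snd-pair cell env) (⊢compile n a))
    (⊢comp (⊢pair (⊢comp (⊢fst-pair cell env) (⊢snd-pair 1 parts)) (⊢snd-pair cell env))
           (⊢compile c ((x , xs) , a))))
  where
  env   = ⌜_⌝ {A} a
  cell  = ⌜_⌝ {list B} (x ∷ xs)
  parts = ⌜_⌝ {B ⊗ list B} (x , xs)
⊢compile (switch t as)  a = ⊢comp (⊢pair (⊢compile t a) ⊢id) (⊢compileA as (run t a) a)

⊢compileA (otherwise t) k       a = ⊢compile t (k , a)
⊢compileA (t ∣ as)      zero    a = ⊢natCase-zero (⊢compile t a)
⊢compileA {B = B} (t ∣ as) (suc k) a =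
  ⊢natCase-suc (λ k → ⌜_⌝ {B} (runA as k a)) (⊢compile t a) (λ k → ⊢compileA as k a) k

-- A universal stack machine

-- A configuration is a current value with a stack of frames (tag, a, b, c), where tag 5 + t with
-- a = m applies the code with index pair t m to the current value. The other tags are:
--   0: save the current value and apply the right child of a to b
--   1: pair the saved value a with the current one
--   2: with current value r, apply the right child of a to pair b (pair r c)
--   3: recursion for a with b iterations and parameter c
--   4: minimisation for a on b, whose candidate c has just been tested
Frame Config : Ty
Frame  = nat ⊗ nat ⊗ nat ⊗ nat
Config = nat ⊗ list Frame

left right : ∀ {A} → Tm A nat → Tm A nat
left t  = fst′ (unpair′ t)
right t = snd′ (unpair′ t)

literal : ∀ {A} → ℕ → Tm A nat
literal zero    = zero′
literal (suc n) = suc′ (literal n)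

apply : ∀ {A} → Tm A nat → Tm A Frame
apply e = ⟨ suc′ (suc′ (suc′ (suc′ (suc′ (left e))))) , ⟨ right e , ⟨ zero′ , zero′ ⟩ ⟩ ⟩

frame : ∀ {A} → ℕ → Tm A nat → Tm A nat → Tm A nat → Tm A Frame
frame t a b c = ⟨ literal t , ⟨ a , ⟨ b , c ⟩ ⟩ ⟩

step′ : Tm Config Config
-- An empty stack means halting: the configuration is then a fixed point.
step′ = uncons (snd′ arg) arg (switch (tag arg)
  ( ⟨ b arg , apply (right (a arg)) ∷′ frame 1 (val arg) zero′ zero′ ∷′ rest arg ⟩
  ∣ ⟨ pair′ (a arg) (val arg) , rest arg ⟩
  ∣ ⟨ pair′ (b arg) (pair′ (val arg) (c arg)) , apply (right (a arg)) ∷′ rest arg ⟩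
  ∣ switch (b arg)
      ( ⟨ c arg , apply (left (a arg)) ∷′ rest arg ⟩
      ∣ otherwise (let s = snd′ arg ; k = fst′ arg in
          -- The zero is a filler, as a frame with tag 3 ignores the current value.
          ⟨ zero′ , frame 3 (a s) k (c s) ∷′ frame 2 (a s) k (c s) ∷′ rest s ⟩))
  ∣ switch (val arg)
      ( ⟨ c arg , rest arg ⟩
      ∣ otherwise (let s = snd′ arg ; n = suc′ (c s) in
          ⟨ pair′ n (b s) , apply (a s) ∷′ frame 4 (a s) (b s) n ∷′ rest s ⟩))
  -- From here on the tags are 5 plus the constructor numbers of `decodeNode`.
  ∣ ⟨ zero′ , rest arg ⟩
  ∣ ⟨ suc′ (val arg) , rest arg ⟩
  ∣ ⟨ val arg , rest arg ⟩
  ∣ ⟨ left (val arg) , rest arg ⟩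
  ∣ ⟨ right (val arg) , rest arg ⟩
  ∣ ⟨ val arg , apply (left (a arg)) ∷′ frame 0 (a arg) (val arg) zero′ ∷′ rest arg ⟩
  ∣ ⟨ val arg , apply (right (a arg)) ∷′ apply (left (a arg)) ∷′ rest arg ⟩
  ∣ ⟨ val arg , frame 3 (a arg) (left (val arg)) (right (val arg)) ∷′ rest arg ⟩
  ∣ ⟨ pair′ zero′ (val arg) , apply (a arg) ∷′ frame 4 (a arg) (val arg) zero′ ∷′ rest arg ⟩
  -- Constructor numbers from 9 on decode to `cZero`.
  ∣ otherwise ⟨ zero′ , rest (snd′ arg) ⟩))
  where
  module _ {A} (s : Tm A ((Frame ⊗ list Frame) ⊗ Config)) where
    tag a b c val : Tm A nat
    tag = fst′ (fst′ (fst′ s))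
    a   = fst′ (snd′ (fst′ (fst′ s)))
    b   = fst′ (snd′ (snd′ (fst′ (fst′ s))))
    c   = snd′ (snd′ (snd′ (fst′ (fst′ s))))
    val = fst′ (snd′ s)
    rest : Tm A (list Frame)
    rest = snd′ (fst′ s)

stepM : ⟦ Config ⟧ → ⟦ Config ⟧
stepM = run step′

infix 4 _⇒*_

_⇒*_ : ⟦ Config ⟧ → ⟦ Config ⟧ → Set
s ⇒* t = ∃ λ n → iterate stepM s n ≡ t

done : ∀ {s} → s ⇒* s
done = 0 , refl

infixr 2 _then_

_then_ : ∀ {s t u} → s ⇒* t → t ⇒* u → s ⇒* u
_then_ {s} (n , eq) (m , eq′) = n + m , trans (iterate-+ n s) (trans (cong (λ t → iterate stepM t m) eq) eq′)
  where
  iterate-+ : ∀ n s → iterate stepM s (n + m) ≡ iterate stepM (iterate stepM s n) m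
  iterate-+ zero    s = refl
  iterate-+ (suc n) s = iterate-+ n (stepM s)

tick : ∀ {s t} → stepM s ⇒* t → s ⇒* t
tick (n , eq) = suc n , eq

-- Rep c (t , m): the number pair t m decodes to c.
data Rep : Code → ℕ × ℕ → Set where
  rZero : ∀ {m} → Rep cZero (0 , m)
  rSucc : ∀ {m} → Rep cSucc (1 , m)
  rId   : ∀ {m} → Rep cId (2 , m)
  rFst  : ∀ {m} → Rep cFst (3 , m)
  rSnd  : ∀ {m} → Rep cSnd (4 , m)
  rPair : ∀ {f g m} → Rep f (unpair (proj₁ (unpair m))) → Rep g (unpair (proj₂ (unpair m))) →
          Rep (cPair f g) (5 , m)
  rComp : ∀ {f g m} → Rep f (unpair (proj₁ (unpair m))) → Rep g (unpair (proj₂ (unpair m))) →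
          Rep (cComp f g) (6 , m)
  rRec  : ∀ {f g m} → Rep f (unpair (proj₁ (unpair m))) → Rep g (unpair (proj₂ (unpair m))) →
          Rep (cRec f g) (7 , m)
  rMu   : ∀ {f m} → Rep f (unpair m) → Rep (cMu f) (8 , m)
  rJunk : ∀ {t m} → Rep cZero (9 + t , m)

-- Covers all numbers and not only values of `encode`, since conjectures of a learner are arbitrary
-- indices.
decodeF-rep : ∀ f e → e < f → Rep (decodeF f e) (unpair e)
decodeF-rep (suc f) e (s≤s e≤f) =
  subst (λ c → Rep c (unpair e)) (sym (decodeF-suc f e)) (node (unpair e) (≤-trans (unpair-sum-≤ e) e≤f))
  where
  child : ∀ t m → suc t + m ≤ f → m < f
  child t m le = ≤-trans (s≤s (m≤n+m m t)) le
  childˡ : ∀ t m → suc t + m ≤ f → Rep (decodeF f (proj₁ (unpair m))) (unpair (proj₁ (unpair m)))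
  childˡ t m le = decodeF-rep f _ (≤-<-trans (≤-trans (m≤m+n _ _) (unpair-sum-≤ m)) (child t m le))
  childʳ : ∀ t m → suc t + m ≤ f → Rep (decodeF f (proj₂ (unpair m))) (unpair (proj₂ (unpair m)))
  childʳ t m le = decodeF-rep f _ (≤-<-trans (≤-trans (m≤n+m _ (proj₁ (unpair m))) (unpair-sum-≤ m)) (child t m le))
  node : ∀ e → proj₁ e + proj₂ e ≤ f → Rep (decodeNode (decodeF f) e) e
  node (0 , m) le = rZero
  node (1 , m) le = rSucc
  node (2 , m) le = rId
  node (3 , m) le = rFst
  node (4 , m) le = rSnd
  node (5 , m) le = rPair (childˡ 4 m le) (childʳ 4 m le)
  node (6 , m) le = rComp (childˡ 5 m le) (childʳ 5 m le)
  node (7 , m) le = rRec (childˡ 6 m le) (childʳ 6 m le)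
  node (8 , m) le = rMu (decodeF-rep f m (child 7 m le))
  node (suc (suc (suc (suc (suc (suc (suc (suc (suc t)))))))) , m) le = rJunk

codeFrame : ℕ × ℕ → ⟦ Frame ⟧
codeFrame (t , m) = 5 + t , m , 0 , 0

-- Induction on derivations. `K` is arbitrary because subcomputations run on top of the frames that
-- wait for their values.
simulate : ∀ {c x v e} → c ⊢ x ↦ v → Rep c e → ∀ K → (x , codeFrame e ∷ K) ⇒* (v , K)
simulate-loop : ∀ {f g y k v m} → Loop f g y k v →
                Rep f (unpair (proj₁ (unpair m))) → Rep g (unpair (proj₂ (unpair m))) →
                ∀ x K → (x , (3 , m , k , y) ∷ K) ⇒* (v , K)
simulate-search : ∀ {f x n v m} → Search f x n v → Rep f (unpair m) →
                  ∀ K → (pair n x , codeFrame (unpair m) ∷ (4 , m , x , n) ∷ K) ⇒* (v , K)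

simulate ⊢zero rZero K = tick done
simulate ⊢zero rJunk K = tick done
simulate ⊢succ rSucc K = tick done
simulate ⊢id   rId   K = tick done
simulate ⊢fst  rFst  K = tick done
simulate ⊢snd  rSnd  K = tick done
simulate (⊢pair df dg) (rPair rf rg) K = tick (simulate df rf _ then tick (simulate dg rg _ then tick done))
simulate (⊢comp dg df) (rComp rf rg) K = tick (simulate dg rg _ then simulate df rf K)
simulate (⊢rec l)      (rRec rf rg)  K = tick (simulate-loop l rf rg _ K)
simulate (⊢mu d)       (rMu rf)      K = tick (simulate-search d rf K)

simulate-loop (base d)   rf rg x K = tick (simulate d rf K)
simulate-loop (step l d) rf rg x K = tick (simulate-loop l rf rg 0 _ then tick (simulate d rg K))

simulate-search (found d)   rf K = simulate d rf _ then tick done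
simulate-search (next d ds) rf K = simulate d rf _ then tick (simulate-search ds rf K)

initial′ : Tm (nat ⊗ nat) Config
initial′ = ⟨ snd′ arg , apply (fst′ arg) ∷′ []′ ⟩

running′ : Tm Config nat
running′ = uncons (snd′ arg) zero′ (suc′ zero′)

runFor : Code
runFor = cRec (compile initial′) (cComp (compile step′) (cComp cFst cSnd))

-- Kleene normal form: minimise the number of steps until the stack is empty, then rerun that many
-- and read off the value.
universal : Code
universal = cComp cFst (cComp runFor (cPair (cMu (cComp (compile running′) runFor)) cId))

⊢runFor : ∀ n e x → runFor ⊢ pair n (pair e x) ↦ ⌜_⌝ {Config} (fold (run initial′ (e , x)) stepM n)
⊢runFor n e x = ⊢rec-pair n (pair e x) (loop n)
  where
  loop : ∀ n → Loop (compile initial′) (cComp (compile step′) (cComp cFst cSnd)) (pair e x) n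
                    (⌜_⌝ {Config} (fold (run initial′ (e , x)) stepM n))
  loop zero    = base (⊢compile initial′ (e , x))
  loop (suc n) = step (loop n)
    (⊢comp (⊢comp (⊢snd-pair n (pair r (pair e x))) (⊢fst-pair r (pair e x)))
           (⊢compile step′ (fold (run initial′ (e , x)) stepM n)))
    where r = ⌜_⌝ {Config} (fold (run initial′ (e , x)) stepM n)

-- Simulation gives some halting time `N`; halted configurations are fixed, so the least halting
-- time shows the same value.
⊢universal : ∀ {e x v} → decode e ⊢ x ↦ v → universal ⊢ pair e x ↦ v
⊢universal {e} {x} {v} d = result (least (λ n → run running′ (config n) ≟ 0) N (cong (run running′) config-N))
  where
  config : ℕ → ⟦ Config ⟧
  config n = fold (run initial′ (e , x)) stepM n

  sim : run initial′ (e , x) ⇒* (v , [])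
  sim = simulate d (decodeF-rep (suc e) e ≤-refl) []
  N = proj₁ sim

  config-N : config N ≡ (v , [])
  config-N = trans (iterate-is-fold (run initial′ (e , x)) stepM N) (proj₂ sim)

  halted : ∀ s → run running′ s ≡ 0 → stepM s ≡ s
  halted (v , []) _ = refl

  stays : ∀ k m → run running′ (config m) ≡ 0 → config (k + m) ≡ config m
  stays zero    m h = refl
  stays (suc k) m h = trans (cong stepM (stays k m h)) (halted (config m) h)

  test : ∀ n → cComp (compile running′) runFor ⊢ pair n (pair e x) ↦ run running′ (config n)
  test n = ⊢comp (⊢runFor n e x) (⊢compile running′ (config n))

  test-suc : ∀ n → ¬ run running′ (config n) ≡ 0 →
             ∃ λ w → cComp (compile running′) runFor ⊢ pair n (pair e x) ↦ suc w
  test-suc n ¬0 with run running′ (config n) | test n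
  ... | zero  | _ = contradiction refl ¬0
  ... | suc w | t = w , t

  result : (∃ λ m → run running′ (config m) ≡ 0 × (∀ {k} → k < m → ¬ run running′ (config k) ≡ 0)) →
           universal ⊢ pair e x ↦ v
  result (m , halts , below) =
    ⊢comp (⊢comp (⊢pair (⊢mu-least (λ n eq → subst (_ ⊢ pair n (pair e x) ↦_) eq (test n)) test-suc halts below) ⊢id)
                 (⊢runFor m e x))
          (subst (λ s → cFst ⊢ ⌜_⌝ {Config} s ↦ v) (sym config-m) (⊢fst-pair v 0))
    where
    m≤N : m ≤ N
    m≤N = ≮⇒≥ λ N<m → below N<m (cong (run running′) config-N)
    config-m : config m ≡ (v , [])
    config-m = trans (sym (stays (N ∸ m) m halts)) (trans (cong config (m∸n+n≡m m≤N)) config-N)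

-- The learner

one : Code
one = cComp cSucc cZero

⊢one : ∀ {x} → one ⊢ x ↦ 1
⊢one = ⊢comp ⊢zero ⊢succ

predCode : Code
predCode = compile {nat} {nat} (switch arg (zero′ ∣ otherwise (fst′ arg)))

⊢pred-suc : ∀ n → predCode ⊢ suc n ↦ n
⊢pred-suc n = ⊢compile {nat} {nat} (switch arg (zero′ ∣ otherwise (fst′ arg))) (suc n)

-- On pair n z, with z an input on which H conjectures e: is n the code of # or of an element of C e?
inHypothesis : Code → Code
inHypothesis H = ifZero cFst one (cComp universal (cPair (cComp predCode (cComp H cSnd)) (cComp predCode cFst)))

-- Zero signals success, as `cMu` looks for a zero. `H` runs on a candidate only after the
-- membership test, since it may diverge outside the data.
uninformative : Code → Code
uninformative H = ifZero (inHypothesis H) one (ifZero (cComp H cFst) one cZero)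

-- Answers `?` are kept; the search starts only from an input that carries a conjecture.
stabilised : Code → Code
stabilised H = ifZero H cZero (cComp H (cMu (uninformative H)))

-- Numbers are input codes. The pause symbol counts as a datum of every text, since inserting it
-- leaves the content unchanged.
Datum : Text → ℕ → Set
Datum T zero    = ⊤
Datum T (suc x) = content T x

module _ (H : Code) (T : Text)
         (respond : ∀ n → Datum T n → (H ⊢ n ↦ 0) ⊎ ∃ λ e → (H ⊢ n ↦ suc e) × CorrectC e T) where

  Informative : ℕ → Set
  Informative n = Datum T n × ∃ λ e → (H ⊢ n ↦ suc e) × CorrectC e T

  module _ {z} (inf : Informative z) where
    private
      e : ℕ
      e = proj₁ (proj₂ inf)
      He : H ⊢ z ↦ suc e
      He = proj₁ (proj₂ (proj₂ inf))

    ⊢inHypothesis-suc : ∀ {x v} → e · x ⇓ v → inHypothesis H ⊢ pair (suc x) z ↦ v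
    ⊢inHypothesis-suc {x} e↓ = ⊢ifZero-suc (⊢fst-pair (suc x) z) ⊢one
      (⊢comp (⊢pair (⊢comp (⊢comp (⊢snd-pair (suc x) z) He) (⊢pred-suc e))
                    (⊢comp (⊢fst-pair (suc x) z) (⊢pred-suc x)))
             (⊢universal (⇓⇒⊢ e↓)))

    -- A correct conjecture is a C-index, whose value 0 or 1 decides the otherwise undecided content
    -- of `T`.
    ⊢inHypothesis : ∀ n → (Datum T n × inHypothesis H ⊢ pair n z ↦ 1)
                   ⊎ (¬ Datum T n × inHypothesis H ⊢ pair n z ↦ 0)
    ⊢inHypothesis zero = inj₁ (tt , ⊢ifZero-zero (⊢fst-pair 0 z) ⊢one)
    ⊢inHypothesis (suc x) with proj₂ (proj₂ (proj₂ inf))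
    ... | total , C⇔ with total x
    ...   | 0 , e↓ , _ =
      inj₂ ((λ c → contradiction (⇓-deterministic {e} e↓ (from (C⇔ x) c)) λ ()) , ⊢inHypothesis-suc e↓)
    ...   | 1 , e↓ , _ = inj₁ (to (C⇔ x) e↓ , ⊢inHypothesis-suc e↓)
    ...   | suc (suc _) , _ , s≤s ()

    ⊢uninformative : ∀ n → (Informative n × uninformative H ⊢ pair n z ↦ 0)
                    ⊎ (¬ Informative n × uninformative H ⊢ pair n z ↦ 1)
    ⊢uninformative n with ⊢inHypothesis n
    ... | inj₂ (∉ , test) = inj₂ (∉ ∘ proj₁ , ⊢ifZero-zero test ⊢one)
    ... | inj₁ (∈ , test) with respond n ∈
    ...   | inj₁ H0 = inj₂ ((λ { (_ , _ , H+ , _) → contradiction (⊢-deterministic H0 H+) λ () })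
                           , ⊢ifZero-suc test ⊢one (⊢ifZero-zero (⊢comp (⊢fst-pair n z) H0) ⊢one))
    ...   | inj₂ (e′ , H+ , correct) =
      inj₁ ((∈ , e′ , H+ , correct) , ⊢ifZero-suc test ⊢one (⊢ifZero-suc (⊢comp (⊢fst-pair n z) H+) ⊢one ⊢zero))

    informative? : ∀ n → Dec (Informative n)
    informative? n with ⊢uninformative n
    ... | inj₁ (yes-n , _) = yes yes-n
    ... | inj₂ (no-n , _)  = no no-n

    ⊢search : ∀ {m} → Informative m → (∀ {k} → k < m → ¬ Informative k) → cMu (uninformative H) ⊢ z ↦ m
    ⊢search = ⊢mu-least hit miss
      where
      hit : ∀ n → Informative n → uninformative H ⊢ pair n z ↦ 0
      hit n yes-n with ⊢uninformative n
      ... | inj₁ (_ , test) = test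
      ... | inj₂ (no-n , _) = contradiction yes-n no-n
      miss : ∀ n → ¬ Informative n → ∃ λ w → uninformative H ⊢ pair n z ↦ suc w
      miss n no-n with ⊢uninformative n
      ... | inj₁ (yes-n , _) = contradiction yes-n no-n
      ... | inj₂ (_ , test)  = 0 , test

  -- The least informative datum does not depend on the datum from which the search starts.
  stabilised-constant : ∃ Informative → ∃ λ e → CorrectC e T × (∀ {z} → Informative z → stabilised H ⊢ z ↦ suc e)
  stabilised-constant (z₀ , inf₀) with least (informative? inf₀) z₀ inf₀
  ... | m , inf-m@(_ , e , Hm , correct) , below = e , correct , λ inf →
    ⊢ifZero-suc (proj₁ (proj₂ (proj₂ inf))) ⊢zero (⊢comp (⊢search inf inf-m below) Hm)

-- Texts in which one datum recurs.

interleave : Maybe ℕ → Text → Text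
interleave d T zero          = d
interleave d T (suc zero)    = T 0
interleave d T (suc (suc i)) = interleave d (T ∘ suc) i

interleave-even : ∀ d T n → interleave d T (n + n) ≡ d
interleave-even d T zero = refl
interleave-even d T (suc n) rewrite +-suc n n = interleave-even d (T ∘ suc) n

interleave-odd : ∀ d T n → interleave d T (suc (n + n)) ≡ T n
interleave-odd d T zero = refl
interleave-odd d T (suc n) rewrite +-suc n n = interleave-odd d (T ∘ suc) n

interleave-content : ∀ d T i {x} → interleave d T i ≡ just x → d ≡ just x ⊎ content T x
interleave-content d T zero eq = inj₁ eq
interleave-content d T (suc zero) eq = inj₂ (0 , eq)
interleave-content d T (suc (suc i)) eq with interleave-content d (T ∘ suc) i eq
... | inj₁ d≡      = inj₁ d≡
... | inj₂ (j , q) = inj₂ (suc j , q)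

content-interleave : ∀ d T → (∀ {x} → d ≡ just x → content T x) → ∀ x → content (interleave d T) x ⇔ content T x
content-interleave d T d∈T x = mk⇔ fwd λ (i , eq) → suc (i + i) , trans (interleave-odd d T i) eq
  where
  fwd : content (interleave d T) x → content T x
  fwd (i , eq) with interleave-content d T i eq
  ... | inj₁ d≡ = d∈T d≡
  ... | inj₂ c  = c

CorrectC-content : ∀ {e T T′} → (∀ x → content T x ⇔ content T′ x) → CorrectC e T → CorrectC e T′
CorrectC-content T⇔T′ (total , C⇔) =
  total , λ x → mk⇔ (to (T⇔T′ x) ∘ to (C⇔ x)) (from (C⇔ x) ∘ from (T⇔T′ x))

-- A datum repeated forever is answered correctly, since its answer recurs in the hypothesis sequence.
respond-correct : ∀ {h L T} → TdLearns BcC h L → TextFor T L → ∀ d → (∀ {x} → d ≡ just x → content T x) →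
                  (h · encIn d ⇓ 0) ⊎ ∃ λ e → (h · encIn d ⇓ suc e) × CorrectC e T
respond-correct {h} {L} {T} learns textFor d d∈T
  with learns (interleave d T) (λ x → mk⇔ (to (textFor x) ∘ to (same x)) (from (same x) ∘ from (textFor x)))
  where same = content-interleave d T d∈T
-- Position `n₀ + n₀` is even, so it carries `d`, and the hypothesis right after it is already in
-- the correct range.
... | p , (_ , steps) , n₀ , good with steps (n₀ + n₀) | interleave-even d T n₀
...   | inj₁ (h↓ , _) | eq = inj₁ (subst (λ d → h · encIn d ⇓ 0) eq h↓)
...   | inj₂ (e , h↓ , p≡) | eq with good (suc (n₀ + n₀)) (m≤n⇒m≤1+n (m≤m+n n₀ n₀))
...     | e′ , p≡′ , correct with just-injective (trans (sym p≡) p≡′)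
...       | refl = inj₂ (e , subst (λ d → h · encIn d ⇓ suc e) eq h↓
                      , CorrectC-content (content-interleave d T d∈T) correct)

-- From behaviourally correct to explanatory learning.

IsTd-hypothesis : ∀ {h T p e} → IsTd h T p → ∀ n → p n ≡ just e → ∃ λ i → ∃ λ e → h · encIn (T i) ⇓ suc e
-- The sequence starts with `?`, so a hypothesis can only stem from an earlier answer.
IsTd-hypothesis (p0 , _) zero eq with trans (sym p0) eq
... | ()
IsTd-hypothesis td@(_ , steps) (suc n) eq with steps n
... | inj₁ (_ , same)    = IsTd-hypothesis td n (trans (sym same) eq)
... | inj₂ (e , h↓ , _)  = n , e , h↓

-- When all answers other than `?` agree, the first of them fixes the hypothesis for good.
constant-answers⇒Ex : ∀ {h T e} → (∀ i → (h · encIn (T i) ⇓ 0) ⊎ (h · encIn (T i) ⇓ suc e)) →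
                      ∀ i₀ → h · encIn (T i₀) ⇓ suc e → CorrectC e T → ∃ λ p → IsTd h T p × ExC p T
constant-answers⇒Ex {h} {T} {e} answer i₀ answer₀ correct = p , (refl , isTd) , suc i₀ , e , stable , correct
  where
  p : HypSeq
  p zero = nothing
  p (suc i) with answer i
  ... | inj₁ _ = p i
  ... | inj₂ _ = just e

  isTd : ∀ i → ((h · encIn (T i) ⇓ 0) × p (suc i) ≡ p i)
             ⊎ (∃ λ e → (h · encIn (T i) ⇓ suc e) × p (suc i) ≡ just e)
  isTd i with answer i
  ... | inj₁ d = inj₁ (d , refl)
  ... | inj₂ d = inj₂ (e , d , refl)

  stable : ∀ n → suc i₀ ≤ n → p n ≡ just e
  stable (suc n) (s≤s i₀≤n) with answer n | m≤n⇒m<n∨m≡n i₀≤n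
  ... | inj₂ _ | _         = refl
  ... | inj₁ _ | inj₁ i₀<n = stable n i₀<n
  ... | inj₁ d | inj₂ refl = contradiction (⇓-deterministic {h} d answer₀) λ ()

-- The new index enters only through its decoding equation and is never computed.
Bc⇒Ex : ∀ {h h′ L} → decode h′ ≡ stabilised (decode h) → TdLearns BcC h L → TdLearns ExC h′ L
Bc⇒Ex {h} {h′} {L} h′≡ learns T textFor =
  constant-answers⇒Ex answer i₀ (⊢⇒⇓′ (proj₂ (proj₂ constant) informative₀)) (proj₁ (proj₂ constant))
  where
  H = decode h

  respond : ∀ n → Datum T n → (H ⊢ n ↦ 0) ⊎ ∃ λ e → (H ⊢ n ↦ suc e) × CorrectC e T
  respond n n∈T with respond-correct learns textFor (datum n) (datum∈T n n∈T)
    where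
    datum : ℕ → Maybe ℕ
    datum zero    = nothing
    datum (suc x) = just x
    datum∈T : ∀ n → Datum T n → ∀ {x} → datum n ≡ just x → content T x
    datum∈T (suc x) x∈T refl = x∈T
  -- Splitting on the input lets `encIn (datum n)` reduce to `n`.
  respond zero    _ | inj₁ h↓                = inj₁ (⇓⇒⊢ h↓)
  respond zero    _ | inj₂ (e , h↓ , ok)     = inj₂ (e , ⇓⇒⊢ h↓ , ok)
  respond (suc x) _ | inj₁ h↓                = inj₁ (⇓⇒⊢ h↓)
  respond (suc x) _ | inj₂ (e , h↓ , ok)     = inj₂ (e , ⇓⇒⊢ h↓ , ok)

  ⊢⇒⇓′ : ∀ {x v} → stabilised H ⊢ x ↦ v → h′ · x ⇓ v
  ⊢⇒⇓′ {x} {v} d = ⊢⇒⇓ (subst (λ c → c ⊢ x ↦ v) (sym h′≡) d)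

  input∈T : ∀ i → Datum T (encIn (T i))
  input∈T i with T i in eq
  ... | nothing = tt
  ... | just x  = i , eq

  -- Convergence on `T` itself requires some hypothesis, hence an informative datum exists.
  first : ∃ λ i → ∃ λ e → h · encIn (T i) ⇓ suc e
  first with learns T textFor
  ... | _ , td , n₀ , good = IsTd-hypothesis td n₀ (proj₁ (proj₂ (good n₀ ≤-refl)))

  i₀ = proj₁ first

  informative₀ : Informative H T respond (encIn (T i₀))
  informative₀ with respond (encIn (T i₀)) (input∈T i₀)
  ... | inj₁ H0 = contradiction (⊢-deterministic H0 (⇓⇒⊢ (proj₂ (proj₂ first)))) λ ()
  ... | inj₂ r  = input∈T i₀ , r

  constant : ∃ λ e → CorrectC e T × (∀ {z} → Informative H T respond z → stabilised H ⊢ z ↦ suc e)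
  constant = stabilised-constant H T respond (_ , informative₀)

  answer : ∀ i → (h′ · encIn (T i) ⇓ 0) ⊎ (h′ · encIn (T i) ⇓ suc (proj₁ constant))
  answer i = Sum.map (λ H0 → ⊢⇒⇓′ (⊢ifZero-zero H0 ⊢zero))
                     (λ r → ⊢⇒⇓′ (proj₂ (proj₂ constant) (input∈T i , r)))
                     (respond (encIn (T i)) (input∈T i))

Ex⇒Bc : ∀ {h L} → TdLearns ExC h L → TdLearns BcC h L
Ex⇒Bc learns T textFor with learns T textFor
... | p , td , n₀ , e , stable , correct = p , td , n₀ , λ n n₀≤n → e , stable n n₀≤n , correct

theorem18 : (𝓛 : Class) → (∀ L → 𝓛 L → Recursive L) →
    TdLearnable ExC 𝓛 ⇔ TdLearnable BcC 𝓛
theorem18 𝓛 _ = mk⇔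
  (λ (h , learns) → h , λ L L∈𝓛 → Ex⇒Bc {h} (learns L L∈𝓛))
  (λ (h , learns) → let h′ , h′≡ = hasIndex (stabilised (decode h)) in
     h′ , λ L L∈𝓛 → Bc⇒Ex h′≡ (learns L L∈𝓛))
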